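{- Let $\mathbf{a}=(a_{1},\ldots,a_{n})\in\mathbb{C}^n$ and $\mathbf{b}=(b_{1},\ldots,b_{m})\in\mathbb{C}^m$ be two $Id$-quiddity sequences. Then $\mathbf{a}\circ_{k}\mathbf{b}$ is an $Id$-quiddity sequence for $k=1,\ldots,n$, where $$\mathbf{a}\circ_{k}\mathbf{b}=(a_{1},\ldots, a_{k-1},a_{k}+b_{1}-1,b_{2},\ldots,b_{m-1},b_{m}-1,a_{k+1}-1,a_{k+2},\ldots,a_{n})$$ for $k\neq n$, and $$\mathbf{a}\circ_{n}\mathbf{b}=(a_{1}-1,a_{2},\ldots,a_{n-1},a_{n}+b_{1}-1,b_{2},\ldots,b_{m-1},b_{m}-1).$$
   Context: A vector $(a_1,\ldots,a_n)\in\mathbb{C}^n$ is called an $Id$-quiddity sequence if $$\begin{pmatrix} a_{n} & -1\\ 1 & 0\end{pmatrix}\begin{pmatrix} a_{n-1} & -1\\ 1 & 0\end{pmatrix}\cdots\begin{pmatrix} a_{1} & -1\\ 1 & 0\end{pmatrix}=Id,$$ the $2\times 2$ identity matrix. -}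

module Defs where

open import Algebra.Bundles using (CommutativeRing)
open import Algebra.Structures using (IsCommutativeRing)
open import Data.Fin.Base using (Fin; zero; suc; fromℕ)
open import Data.Fin.Relation.Unary.Top using (view; ‵fromℕ; ‵inject₁)
open import Data.Nat.Base as ℕ using (ℕ; zero; suc; _⊔_)
import Data.Nat.Properties as ℕ
open import Data.Product.Base using (∃; _×_; _,_)
open import Data.Rational.Base as ℚ using (ℚ; 0ℚ; 1ℚ; ½; ∣_∣)
import Data.Rational.Properties as ℚ
open import Data.Vec.Base using (Vec; []; _∷_; _++_; cast; lookup; _[_]%=_)
open import Level using (Level; 0ℓ)
open import Relation.Binary.PropositionalEquality
  using (_≡_; refl; sym; trans; cong; subst; subst₂)
open import Relation.Binary.Structures using (IsEquivalence)

private
  variable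
    c ℓ : Level
    A   : Set c
    m n : ℕ

-- ℝ is the setoid of Cauchy sequences of rationals modulo null sequences.

IsCauchy : (ℕ → ℚ) → Set
IsCauchy x = ∀ ε → 0ℚ ℚ.< ε →
  ∃ λ N → ∀ m n → N ℕ.≤ m → N ℕ.≤ n → ∣ x m ℚ.- x n ∣ ℚ.< ε

record ℝ : Set where
  constructor mkℝ
  field
    seq    : ℕ → ℚ
    cauchy : IsCauchy seq

open ℝ

infix 4 _≈ℝ_

record _≈ℝ_ (x y : ℝ) : Set where
  constructor mk≈ℝ
  field
    close : ∀ ε → 0ℚ ℚ.< ε →
      ∃ λ N → ∀ n → N ℕ.≤ n → ∣ seq x n ℚ.- seq y n ∣ ℚ.< ε

open _≈ℝ_

private
  module Differences (R : CommutativeRing c ℓ) where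

    open CommutativeRing R hiding (refl; sym; trans)
    open import Algebra.Properties.Ring ring
      using (-‿+-comm; -‿involutive; [y-z]x≈yx-zx; x[y-z]≈xy-xz)
    open import Algebra.Properties.CommutativeSemigroup +-commutativeSemigroup
      using (interchange)
    open import Relation.Binary.Reasoning.Setoid setoid

    diff-cancel : ∀ a b → a - b + b ≈ a
    diff-cancel a b = begin
      a - b + b       ≈⟨ +-assoc a (- b) b ⟩
      a + (- b + b)   ≈⟨ +-congˡ (-‿inverseˡ b) ⟩
      a + 0#          ≈⟨ +-identityʳ a ⟩
      a               ∎

    diff-trans : ∀ a b c → (a - b) + (b - c) ≈ a - c
    diff-trans a b c = begin
      (a - b) + (b - c) ≈⟨ +-assoc (a - b) b (- c) ⟨
      a - b + b - c     ≈⟨ +-congʳ (diff-cancel a b) ⟩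
      a - c             ∎

    diff-neg : ∀ a b → - (a - b) ≈ - a - - b
    diff-neg a b = CommutativeRing.sym R (-‿+-comm a (- b))

    diff-swap : ∀ a b → - (a - b) ≈ b - a
    diff-swap a b = begin
      - (a - b)   ≈⟨ diff-neg a b ⟩
      - a - - b   ≈⟨ +-congˡ (-‿involutive b) ⟩
      - a + b     ≈⟨ +-comm (- a) b ⟩
      b - a       ∎

    diff-+ : ∀ a b c d → (a - c) + (b - d) ≈ (a + b) - (c + d)
    diff-+ a b c d = begin
      (a - c) + (b - d)       ≈⟨ interchange a (- c) b (- d) ⟩
      (a + b) + (- c - d)     ≈⟨ +-congˡ (-‿+-comm c d) ⟩
      (a + b) - (c + d)       ∎

    diff-* : ∀ a b c d → (a - c) * b + (b - d) * c ≈ a * b - c * d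
    diff-* a b c d = begin
      (a - c) * b + (b - d) * c         ≈⟨ +-cong ([y-z]x≈yx-zx b a c) (*-comm (b - d) c) ⟩
      (a * b - c * b) + c * (b - d)     ≈⟨ +-congˡ (x[y-z]≈xy-xz c b d) ⟩
      (a * b - c * b) + (c * b - c * d) ≈⟨ diff-trans (a * b) (c * b) (c * d) ⟩
      a * b - c * d                     ∎

  open Differences ℚ.+-*-commutativeRing

  Small : (ℕ → ℕ → ℚ) → Set
  Small f = ∀ ε → 0ℚ ℚ.< ε →
    ∃ λ N → ∀ m n → N ℕ.≤ m → N ℕ.≤ n → ∣ f m n ∣ ℚ.< ε

  Bounded : (ℕ → ℕ → ℚ) → Set
  Bounded f = ∃ λ B → 0ℚ ℚ.< B ×
    ∃ λ N → ∀ m n → N ℕ.≤ m → N ℕ.≤ n → ∣ f m n ∣ ℚ.< B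

  small-resp : ∀ {f g} → (∀ m n → f m n ≡ g m n) → Small f → Small g
  small-resp eq sf ε 0<ε with sf ε 0<ε
  ... | N , h = N , λ m n p q → subst (λ z → ∣ z ∣ ℚ.< ε) (eq m n) (h m n p q)

  small-0 : Small (λ _ _ → 0ℚ)
  small-0 ε 0<ε = 0 , λ _ _ _ _ → 0<ε

  half-pos : ∀ {ε} → 0ℚ ℚ.< ε → 0ℚ ℚ.< ½ ℚ.* ε
  half-pos {ε} 0<ε = subst (ℚ._< ½ ℚ.* ε) (ℚ.*-zeroʳ ½) (ℚ.*-monoʳ-<-pos ½ 0<ε)

  half+half : ∀ ε → ½ ℚ.* ε ℚ.+ ½ ℚ.* ε ≡ ε
  half+half ε = trans (sym (ℚ.*-distribʳ-+ ε ½ ½)) (ℚ.*-identityˡ ε)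

  small-+ : ∀ {f g} → Small f → Small g → Small (λ m n → f m n ℚ.+ g m n)
  small-+ {f} {g} sf sg ε 0<ε with sf (½ ℚ.* ε) (half-pos 0<ε) | sg (½ ℚ.* ε) (half-pos 0<ε)
  ... | M , h | N , k = M ⊔ N , λ m n p q →
    subst (∣ f m n ℚ.+ g m n ∣ ℚ.<_) (half+half ε)
      (ℚ.≤-<-trans (ℚ.∣p+q∣≤∣p∣+∣q∣ (f m n) (g m n))
        (ℚ.+-mono-<
          (h m n (ℕ.m⊔n≤o⇒m≤o M N p) (ℕ.m⊔n≤o⇒m≤o M N q))
          (k m n (ℕ.m⊔n≤o⇒n≤o M N p) (ℕ.m⊔n≤o⇒n≤o M N q))))

  small-neg : ∀ {f} → Small f → Small (λ m n → ℚ.- f m n)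
  small-neg {f} sf ε 0<ε with sf ε 0<ε
  ... | N , h = N , λ m n p q →
    subst (ℚ._< ε) (sym (ℚ.∣-p∣≡∣p∣ (f m n))) (h m n p q)

  small-* : ∀ {f g} → Small f → Bounded g → Small (λ m n → f m n ℚ.* g m n)
  small-* {f} {g} sf (B , 0<B , N , k) ε 0<ε = go (sf δ 0<δ)
    where
    instance
      B-pos : ℚ.Positive B
      B-pos = ℚ.positive 0<B

      B-nonNeg : ℚ.NonNegative B
      B-nonNeg = ℚ.pos⇒nonNeg B

      B-nonZero : ℚ.NonZero B
      B-nonZero = ℚ.pos⇒nonZero B

    δ : ℚ
    δ = ε ℚ.* ℚ.1/ B

    0<δ : 0ℚ ℚ.< δ
    0<δ = subst (ℚ._< δ) (ℚ.*-zeroˡ (ℚ.1/ B))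
      (ℚ.*-monoˡ-<-pos (ℚ.1/ B) {{ℚ.1/pos⇒pos B}} 0<ε)

    δB≡ε : δ ℚ.* B ≡ ε
    δB≡ε = trans (ℚ.*-assoc ε (ℚ.1/ B) B)
      (trans (cong (ε ℚ.*_) (ℚ.*-inverseˡ B)) (ℚ.*-identityʳ ε))

    go : (∃ λ M → ∀ m n → M ℕ.≤ m → M ℕ.≤ n → ∣ f m n ∣ ℚ.< δ) →
         ∃ λ M → ∀ m n → M ℕ.≤ m → M ℕ.≤ n → ∣ f m n ℚ.* g m n ∣ ℚ.< ε
    go (M , h) = M ⊔ N , λ m n p q →
      subst₂ ℚ._<_ (sym (ℚ.∣p*q∣≡∣p∣*∣q∣ (f m n) (g m n))) δB≡ε
        (ℚ.≤-<-trans
          (ℚ.*-monoˡ-≤-nonNeg ∣ f m n ∣ {{ℚ.∣-∣-nonNeg (f m n)}}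
            (ℚ.<⇒≤ (k m n (ℕ.m⊔n≤o⇒n≤o M N p) (ℕ.m⊔n≤o⇒n≤o M N q))))
          (ℚ.*-monoˡ-<-pos B
            (h m n (ℕ.m⊔n≤o⇒m≤o M N p) (ℕ.m⊔n≤o⇒m≤o M N q))))

  eventually-bounded : (x : ℝ) → ∃ λ B → 0ℚ ℚ.< B ×
    ∃ λ N → ∀ n → N ℕ.≤ n → ∣ seq x n ∣ ℚ.< B
  eventually-bounded x with cauchy x 1ℚ (ℚ.positive⁻¹ 1ℚ)
  ... | N , h = 1ℚ ℚ.+ ∣ seq x N ∣
    , ℚ.+-mono-<-≤ (ℚ.positive⁻¹ 1ℚ) (ℚ.0≤∣p∣ (seq x N))
    , N , λ n p → subst (λ z → ∣ z ∣ ℚ.< _) (diff-cancel (seq x n) (seq x N))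
        (ℚ.≤-<-trans (ℚ.∣p+q∣≤∣p∣+∣q∣ (seq x n ℚ.- seq x N) (seq x N))
          (ℚ.+-monoˡ-< ∣ seq x N ∣ (h n N p ℕ.≤-refl)))

  boundedˡ : (x : ℝ) → Bounded (λ m _ → seq x m)
  boundedˡ x with eventually-bounded x
  ... | B , 0<B , N , h = B , 0<B , N , λ m _ p _ → h m p

  boundedʳ : (x : ℝ) → Bounded (λ _ n → seq x n)
  boundedʳ x with eventually-bounded x
  ... | B , 0<B , N , h = B , 0<B , N , λ _ n _ q → h n q

  ≈⇒small : ∀ {x y} → x ≈ℝ y → Small (λ n _ → seq x n ℚ.- seq y n)
  ≈⇒small x≈y ε 0<ε with close x≈y ε 0<ε
  ... | N , h = N , λ n _ p _ → h n p

  small⇒≈ : ∀ {x y} → Small (λ n _ → seq x n ℚ.- seq y n) → x ≈ℝ y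
  small⇒≈ s = mk≈ℝ λ ε 0<ε → let N , h = s ε 0<ε in N , λ n p → h n n p p

  pointwise⇒≈ : ∀ {x y} → (∀ n → seq x n ≡ seq y n) → x ≈ℝ y
  pointwise⇒≈ {x} {y} eq = small⇒≈ (small-resp
    (λ n _ → sym (trans (cong (ℚ._- seq y n) (eq n)) (ℚ.+-inverseʳ (seq y n)))) small-0)

fromℚ : ℚ → ℝ
fromℚ q .seq    = λ _ → q
fromℚ q .cauchy = small-resp (λ _ _ → sym (ℚ.+-inverseʳ q)) small-0

infixl 6 _+ℝ_
infixl 7 _*ℝ_
infix  8 -ℝ_

_+ℝ_ : ℝ → ℝ → ℝ
(x +ℝ y) .seq n  = seq x n ℚ.+ seq y n
(x +ℝ y) .cauchy = small-resp
  (λ m n → diff-+ (seq x m) (seq y m) (seq x n) (seq y n))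
  (small-+ (cauchy x) (cauchy y))

-ℝ_ : ℝ → ℝ
(-ℝ x) .seq n  = ℚ.- seq x n
(-ℝ x) .cauchy = small-resp
  (λ m n → diff-neg (seq x m) (seq x n)) (small-neg (cauchy x))

_*ℝ_ : ℝ → ℝ → ℝ
(x *ℝ y) .seq n  = seq x n ℚ.* seq y n
(x *ℝ y) .cauchy = small-resp
  (λ m n → diff-* (seq x m) (seq y m) (seq x n) (seq y n))
  (small-+ (small-* (cauchy x) (boundedˡ y)) (small-* (cauchy y) (boundedʳ x)))

private
  ≈ℝ-isEquivalence : IsEquivalence _≈ℝ_
  ≈ℝ-isEquivalence = record
    { refl  = pointwise⇒≈ λ _ → refl
    ; sym   = λ {x} {y} p → small⇒≈ (small-resp
        (λ n _ → diff-swap (seq x n) (seq y n)) (small-neg (≈⇒small p)))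
    ; trans = λ {x} {y} {z} p q → small⇒≈ (small-resp
        (λ n _ → diff-trans (seq x n) (seq y n) (seq z n))
        (small-+ (≈⇒small p) (≈⇒small q)))
    }

  +ℝ-cong : ∀ {x y u v} → x ≈ℝ y → u ≈ℝ v → x +ℝ u ≈ℝ y +ℝ v
  +ℝ-cong {x} {y} {u} {v} p q = small⇒≈ (small-resp
    (λ n _ → diff-+ (seq x n) (seq u n) (seq y n) (seq v n))
    (small-+ (≈⇒small p) (≈⇒small q)))

  *ℝ-cong : ∀ {x y u v} → x ≈ℝ y → u ≈ℝ v → x *ℝ u ≈ℝ y *ℝ v
  *ℝ-cong {x} {y} {u} {v} p q = small⇒≈ (small-resp
    (λ n _ → diff-* (seq x n) (seq u n) (seq y n) (seq v n))
    (small-+ (small-* (≈⇒small p) (boundedˡ u)) (small-* (≈⇒small q) (boundedˡ y))))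

  -ℝ-cong : ∀ {x y} → x ≈ℝ y → -ℝ x ≈ℝ -ℝ y
  -ℝ-cong {x} {y} p = small⇒≈ (small-resp
    (λ n _ → diff-neg (seq x n) (seq y n)) (small-neg (≈⇒small p)))

ℝ-isCommutativeRing : IsCommutativeRing _≈ℝ_ _+ℝ_ _*ℝ_ -ℝ_ (fromℚ 0ℚ) (fromℚ 1ℚ)
ℝ-isCommutativeRing = record
  { isRing = record
    { +-isAbelianGroup = record
      { isGroup = record
        { isMonoid = record
          { isSemigroup = record
            { isMagma = record
              { isEquivalence = ≈ℝ-isEquivalence
              ; ∙-cong        = +ℝ-cong
              }
            ; assoc = λ x y z → pointwise⇒≈ λ n → ℚ.+-assoc (seq x n) (seq y n) (seq z n)
            }
          ; identity = (λ x → pointwise⇒≈ λ n → ℚ.+-identityˡ (seq x n))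
                     , (λ x → pointwise⇒≈ λ n → ℚ.+-identityʳ (seq x n))
          }
        ; inverse = (λ x → pointwise⇒≈ λ n → ℚ.+-inverseˡ (seq x n))
                  , (λ x → pointwise⇒≈ λ n → ℚ.+-inverseʳ (seq x n))
        ; ⁻¹-cong = -ℝ-cong
        }
      ; comm = λ x y → pointwise⇒≈ λ n → ℚ.+-comm (seq x n) (seq y n)
      }
    ; *-cong     = *ℝ-cong
    ; *-assoc    = λ x y z → pointwise⇒≈ λ n → ℚ.*-assoc (seq x n) (seq y n) (seq z n)
    ; *-identity = (λ x → pointwise⇒≈ λ n → ℚ.*-identityˡ (seq x n))
                 , (λ x → pointwise⇒≈ λ n → ℚ.*-identityʳ (seq x n))
    ; distrib    = (λ x y z → pointwise⇒≈ λ n → ℚ.*-distribˡ-+ (seq x n) (seq y n) (seq z n))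
                 , (λ x y z → pointwise⇒≈ λ n → ℚ.*-distribʳ-+ (seq x n) (seq y n) (seq z n))
    }
  ; *-comm = λ x y → pointwise⇒≈ λ n → ℚ.*-comm (seq x n) (seq y n)
  }

ℝ-commutativeRing : CommutativeRing 0ℓ 0ℓ
ℝ-commutativeRing = record { isCommutativeRing = ℝ-isCommutativeRing }

-- R[i]/(i² + 1); for R = ℝ this is ℂ.
module AdjoinI (R : CommutativeRing c ℓ) where

  open CommutativeRing R hiding (refl; sym; trans)
  private module R = CommutativeRing R
  open import Algebra.Properties.Ring ring
    using (-‿+-comm; -0#≈0#; [y-z]x≈yx-zx; x[y-z]≈xy-xz)
  open import Algebra.Properties.CommutativeSemigroup
    +-commutativeSemigroup using (interchange)
  open import Relation.Binary.Reasoning.Setoid setoid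

  record Complex : Set c where
    constructor _+i_
    field
      re im : Carrier

  open Complex

  record _≈ᶜ_ (z w : Complex) : Set ℓ where
    constructor _,_
    field
      re-≈ : re z ≈ re w
      im-≈ : im z ≈ im w

  _+ᶜ_ : Complex → Complex → Complex
  (a +i b) +ᶜ (c +i d) = (a + c) +i (b + d)

  _*ᶜ_ : Complex → Complex → Complex
  (a +i b) *ᶜ (c +i d) = (a * c - b * d) +i (a * d + b * c)

  -ᶜ_ : Complex → Complex
  -ᶜ (a +i b) = (- a) +i (- b)

  0ᶜ 1ᶜ : Complex
  0ᶜ = 0# +i 0#
  1ᶜ = 1# +i 0#

  private
    *ᶜ-comm : ∀ z w → (z *ᶜ w) ≈ᶜ (w *ᶜ z)
    *ᶜ-comm (a +i b) (c +i d) =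
      +-cong (*-comm a c) (-‿cong (*-comm b d)) ,
      R.trans (+-comm _ _) (+-cong (*-comm b c) (*-comm a d))

    *ᶜ-cong : ∀ {z w u v} → z ≈ᶜ w → u ≈ᶜ v → (z *ᶜ u) ≈ᶜ (w *ᶜ v)
    *ᶜ-cong (p , q) (r , s) =
      +-cong (*-cong p r) (-‿cong (*-cong q s)) , +-cong (*-cong p s) (*-cong q r)

    *ᶜ-assoc : ∀ x y z → ((x *ᶜ y) *ᶜ z) ≈ᶜ (x *ᶜ (y *ᶜ z))
    *ᶜ-assoc (a +i b) (c +i d) (e +i f) = re-part , im-part
      where
      re-part : (a * c - b * d) * e - (a * d + b * c) * f ≈
                a * (c * e - d * f) - b * (c * f + d * e)
      re-part = begin
        (a * c - b * d) * e - (a * d + b * c) * f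
          ≈⟨ +-cong ([y-z]x≈yx-zx e (a * c) (b * d)) (-‿cong (distribʳ f (a * d) (b * c))) ⟩
        (a * c * e - b * d * e) - (a * d * f + b * c * f)
          ≈⟨ +-cong (+-cong (*-assoc a c e) (-‿cong (*-assoc b d e)))
                    (-‿cong (+-cong (*-assoc a d f) (*-assoc b c f))) ⟩
        (a * (c * e) - b * (d * e)) - (a * (d * f) + b * (c * f))
          ≈⟨ +-congˡ (-‿+-comm (a * (d * f)) (b * (c * f))) ⟨
        (a * (c * e) - b * (d * e)) + (- (a * (d * f)) - b * (c * f))
          ≈⟨ interchange (a * (c * e)) (- (b * (d * e))) (- (a * (d * f))) (- (b * (c * f))) ⟩
        (a * (c * e) - a * (d * f)) + (- (b * (d * e)) - b * (c * f))
          ≈⟨ +-cong (x[y-z]≈xy-xz a (c * e) (d * f))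
                    (+-comm (- (b * (c * f))) (- (b * (d * e)))) ⟨
        a * (c * e - d * f) + (- (b * (c * f)) - b * (d * e))
          ≈⟨ +-congˡ (-‿+-comm (b * (c * f)) (b * (d * e))) ⟩
        a * (c * e - d * f) - (b * (c * f) + b * (d * e))
          ≈⟨ +-congˡ (-‿cong (distribˡ b (c * f) (d * e))) ⟨
        a * (c * e - d * f) - b * (c * f + d * e) ∎

      im-part : (a * c - b * d) * f + (a * d + b * c) * e ≈
                a * (c * f + d * e) + b * (c * e - d * f)
      im-part = begin
        (a * c - b * d) * f + (a * d + b * c) * e
          ≈⟨ +-cong ([y-z]x≈yx-zx f (a * c) (b * d)) (distribʳ e (a * d) (b * c)) ⟩
        (a * c * f - b * d * f) + (a * d * e + b * c * e)
          ≈⟨ +-cong (+-cong (*-assoc a c f) (-‿cong (*-assoc b d f)))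
                    (+-cong (*-assoc a d e) (*-assoc b c e)) ⟩
        (a * (c * f) - b * (d * f)) + (a * (d * e) + b * (c * e))
          ≈⟨ interchange (a * (c * f)) (- (b * (d * f))) (a * (d * e)) (b * (c * e)) ⟩
        (a * (c * f) + a * (d * e)) + (- (b * (d * f)) + b * (c * e))
          ≈⟨ +-cong (distribˡ a (c * f) (d * e)) (+-comm (b * (c * e)) (- (b * (d * f)))) ⟨
        a * (c * f + d * e) + (b * (c * e) - b * (d * f))
          ≈⟨ +-congˡ (x[y-z]≈xy-xz b (c * e) (d * f)) ⟨
        a * (c * f + d * e) + b * (c * e - d * f) ∎

    *ᶜ-distribˡ : ∀ x y z → (x *ᶜ (y +ᶜ z)) ≈ᶜ ((x *ᶜ y) +ᶜ (x *ᶜ z))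
    *ᶜ-distribˡ (a +i b) (c +i d) (e +i f) = re-part , im-part
      where
      re-part : a * (c + e) - b * (d + f) ≈ (a * c - b * d) + (a * e - b * f)
      re-part = begin
        a * (c + e) - b * (d + f)
          ≈⟨ +-cong (distribˡ a c e) (-‿cong (distribˡ b d f)) ⟩
        (a * c + a * e) - (b * d + b * f)
          ≈⟨ Differences.diff-+ R (a * c) (a * e) (b * d) (b * f) ⟨
        (a * c - b * d) + (a * e - b * f) ∎

      im-part : a * (d + f) + b * (c + e) ≈ (a * d + b * c) + (a * f + b * e)
      im-part = begin
        a * (d + f) + b * (c + e)
          ≈⟨ +-cong (distribˡ a d f) (distribˡ b c e) ⟩
        (a * d + a * f) + (b * c + b * e)
          ≈⟨ interchange (a * d) (a * f) (b * c) (b * e) ⟩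
        (a * d + b * c) + (a * f + b * e) ∎

    *ᶜ-identityˡ : ∀ z → (1ᶜ *ᶜ z) ≈ᶜ z
    *ᶜ-identityˡ (a +i b) = re-part , im-part
      where
      re-part : 1# * a - 0# * b ≈ a
      re-part = begin
        1# * a - 0# * b ≈⟨ +-cong (*-identityˡ a) (-‿cong (zeroˡ b)) ⟩
        a - 0#          ≈⟨ +-congˡ -0#≈0# ⟩
        a + 0#          ≈⟨ +-identityʳ a ⟩
        a               ∎

      im-part : 1# * b + 0# * a ≈ b
      im-part = begin
        1# * b + 0# * a ≈⟨ +-cong (*-identityˡ b) (zeroˡ a) ⟩
        b + 0#          ≈⟨ +-identityʳ b ⟩
        b               ∎

    ≈ᶜ-isEquivalence : IsEquivalence _≈ᶜ_
    ≈ᶜ-isEquivalence = record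
      { refl  = R.refl , R.refl
      ; sym   = λ { (p , q) → R.sym p , R.sym q }
      ; trans = λ { (p , q) (r , s) → R.trans p r , R.trans q s }
      }

    ≈ᶜ-trans : ∀ {x y z} → x ≈ᶜ y → y ≈ᶜ z → x ≈ᶜ z
    ≈ᶜ-trans = IsEquivalence.trans ≈ᶜ-isEquivalence

    +ᶜ-cong : ∀ {z w u v} → z ≈ᶜ w → u ≈ᶜ v → (z +ᶜ u) ≈ᶜ (w +ᶜ v)
    +ᶜ-cong (p , q) (r , s) = +-cong p r , +-cong q s

  ≈ᶜ-isCommutativeRing : IsCommutativeRing _≈ᶜ_ _+ᶜ_ _*ᶜ_ -ᶜ_ 0ᶜ 1ᶜ
  ≈ᶜ-isCommutativeRing = record
    { isRing = record
      { +-isAbelianGroup = record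
        { isGroup = record
          { isMonoid = record
            { isSemigroup = record
              { isMagma = record
                { isEquivalence = ≈ᶜ-isEquivalence
                ; ∙-cong        = +ᶜ-cong
                }
              ; assoc = λ x y z → +-assoc _ _ _ , +-assoc _ _ _
              }
            ; identity = (λ z → +-identityˡ _ , +-identityˡ _)
                       , (λ z → +-identityʳ _ , +-identityʳ _)
            }
          ; inverse = (λ z → -‿inverseˡ _ , -‿inverseˡ _)
                    , (λ z → -‿inverseʳ _ , -‿inverseʳ _)
          ; ⁻¹-cong = λ { (p , q) → -‿cong p , -‿cong q }
          }
        ; comm = λ z w → +-comm _ _ , +-comm _ _
        }
      ; *-cong     = *ᶜ-cong
      ; *-assoc    = *ᶜ-assoc
      ; *-identity = *ᶜ-identityˡ
                   , λ z → ≈ᶜ-trans (*ᶜ-comm z 1ᶜ) (*ᶜ-identityˡ z)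
      ; distrib    = *ᶜ-distribˡ
                   , λ x y z → ≈ᶜ-trans (*ᶜ-comm (y +ᶜ z) x)
                       (≈ᶜ-trans (*ᶜ-distribˡ x y z)
                         (+ᶜ-cong (*ᶜ-comm x y) (*ᶜ-comm x z)))
      }
    ; *-comm = *ᶜ-comm
    }

  complexRing : CommutativeRing c ℓ
  complexRing = record { isCommutativeRing = ≈ᶜ-isCommutativeRing }

ℂ-commutativeRing : CommutativeRing 0ℓ 0ℓ
ℂ-commutativeRing = AdjoinI.complexRing ℝ-commutativeRing

ℂ : Set
ℂ = CommutativeRing.Carrier ℂ-commutativeRing

-- The cyclic successor: k + 1, except that the last index goes to the first.
next : Fin (suc n) → Fin (suc n)
next k with view k
... | ‵fromℕ     = zero
... | ‵inject₁ i = suc i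

-- splice xs k ys is xs with its k-th entry replaced by the whole of ys.
splice : Vec A (suc n) → Fin (suc n) → Vec A (suc m) → Vec A (suc n ℕ.+ m)
splice {n = n}     {m = m} (_ ∷ xs) zero    ys = cast (cong suc (ℕ.+-comm m n)) (ys ++ xs)
splice {n = suc _}         (x ∷ xs) (suc k) ys = x ∷ splice xs k ys

module Quiddity (R : CommutativeRing c ℓ) where

  open CommutativeRing R

  record Matrix₂ : Set c where
    constructor mat
    field
      e₁₁ e₁₂ e₂₁ e₂₂ : Carrier

  infix 4 _≈ᴹ_

  record _≈ᴹ_ (M N : Matrix₂) : Set ℓ where
    constructor mk≈ᴹ
    private
      module M = Matrix₂ M
      module N = Matrix₂ N
    field
      e₁₁-≈ : M.e₁₁ ≈ N.e₁₁
      e₁₂-≈ : M.e₁₂ ≈ N.e₁₂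
      e₂₁-≈ : M.e₂₁ ≈ N.e₂₁
      e₂₂-≈ : M.e₂₂ ≈ N.e₂₂

  infixl 7 _*ᴹ_

  _*ᴹ_ : Matrix₂ → Matrix₂ → Matrix₂
  mat a b c d *ᴹ mat a′ b′ c′ d′ =
    mat (a * a′ + b * c′) (a * b′ + b * d′)
        (c * a′ + d * c′) (c * b′ + d * d′)

  Id : Matrix₂
  Id = mat 1# 0#
           0# 1#

  η : Carrier → Matrix₂
  η a = mat a  (- 1#)
            1# 0#

  -- The first entry of the sequence gives the rightmost factor.
  product : Vec Carrier n → Matrix₂
  product []       = Id
  product (a ∷ as) = product as *ᴹ η a

  IsIdQuiddity : Vec Carrier n → Set ℓ
  IsIdQuiddity a = product a ≈ᴹ Id

  -- (x + b₁ - 1, b₂, …, bₘ₋₁, bₘ - 1).  For a one-entry b the first and last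
  -- entries coincide and only the first formula is kept; the choice is
  -- immaterial, as a one-entry Id-quiddity sequence would force 1 ≈ 0.
  attach : Carrier → Vec Carrier (suc m) → Vec Carrier (suc m)
  attach {m = zero}  x (b ∷ []) = (x + b - 1#) ∷ []
  attach {m = suc m} x (b ∷ bs) = (x + b - 1#) ∷ (bs [ fromℕ m ]%= (_- 1#))

  -- For k ≠ n the entry aₖ₊₁ is lowered by one, for k = n the entry a₁ is.
  -- The k-th entry is then discarded by splice in favour of attach aₖ b.
  _∘⟨_⟩_ : Vec Carrier (suc n) → Fin (suc n) → Vec Carrier (suc m) →
           Vec Carrier (suc n ℕ.+ m)
  a ∘⟨ k ⟩ b = splice (a [ next k ]%= (_- 1#)) k (attach (lookup a k) b)

open Quiddity ℂ-commutativeRing public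

{-# OPTIONS --safe #-}
-- Shifting an entry is a shear: η (a - c) = η a · lower c and
-- η (a + c) = upper c · η a.  Hence attach x b has the matrix
-- upper (-1) · Id · lower (1 - x) = lower (-1) · η x.  Lowering the entry that
-- cyclically follows x contributes a factor lower 1, which cancels lower (-1):
-- inside the product when k ≠ n, by conjugating the identity when k = n.  A
-- one-entry Id-quiddity sequence forces 1 ≈ 0, where all is trivial.
module Submission where

open import Defs using (splice; module Quiddity)
open import Algebra.Bundles using (CommutativeRing; Monoid)
open import Data.Fin.Base using (Fin; zero; suc; fromℕ; inject₁)
open import Data.Fin.Relation.Unary.Top using (view; ‵fromℕ; ‵inject₁)
open import Data.Nat.Base using (ℕ; zero; suc)
open import Data.Nat.Properties using (suc-injective) renaming (+-comm to +-comm-ℕ)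
open import Data.Product.Base using (_,_)
open import Data.Vec.Base using (Vec; []; _∷_; _++_; cast; lookup; _[_]%=_)
open import Relation.Binary.PropositionalEquality using (_≡_; cong)

-- Only the commutative ring axioms enter, so the argument runs over any `R` and is specialised to ℂ
-- at the end.
module QuiddityProperties {c ℓ} (R : CommutativeRing c ℓ) where

  open CommutativeRing R hiding (zero)
  open Quiddity R
  open import Algebra.Properties.Ring ring
    using (-1*x≈-x; -‿involutive)
  open import Algebra.Solver.Ring.NaturalCoefficients.Default commutativeSemiring
    using (solve; _:=_; _:+_; _:*_; con)

  private
    variable
      m n : ℕ

  ≈ᴹ-refl : ∀ {M} → M ≈ᴹ M
  ≈ᴹ-refl = mk≈ᴹ refl refl refl refl

  ≈ᴹ-sym : ∀ {M N} → M ≈ᴹ N → N ≈ᴹ M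
  ≈ᴹ-sym (mk≈ᴹ p q r s) = mk≈ᴹ (sym p) (sym q) (sym r) (sym s)

  ≈ᴹ-trans : ∀ {L M N} → L ≈ᴹ M → M ≈ᴹ N → L ≈ᴹ N
  ≈ᴹ-trans (mk≈ᴹ p q r s) (mk≈ᴹ p′ q′ r′ s′) =
    mk≈ᴹ (trans p p′) (trans q q′) (trans r r′) (trans s s′)

  *ᴹ-cong : ∀ {K L M N} → K ≈ᴹ L → M ≈ᴹ N → K *ᴹ M ≈ᴹ L *ᴹ N
  *ᴹ-cong (mk≈ᴹ p q r s) (mk≈ᴹ p′ q′ r′ s′) = mk≈ᴹ
    (+-cong (*-cong p p′) (*-cong q r′)) (+-cong (*-cong p q′) (*-cong q s′))
    (+-cong (*-cong r p′) (*-cong s r′)) (+-cong (*-cong r q′) (*-cong s s′))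

  *ᴹ-assoc : ∀ L M N → (L *ᴹ M) *ᴹ N ≈ᴹ L *ᴹ (M *ᴹ N)
  *ᴹ-assoc (mat p q r s) (mat a b c d) (mat t u v w) = mk≈ᴹ
    (entry p q t v) (entry p q u w) (entry r s t v) (entry r s u w)
    where
    entry : ∀ p q t v →
      (p * a + q * c) * t + (p * b + q * d) * v ≈
      p * (a * t + b * v) + q * (c * t + d * v)
    entry p q t v = solve 8 (λ a b c d p q t v →
      (p :* a :+ q :* c) :* t :+ (p :* b :+ q :* d) :* v :=
      p :* (a :* t :+ b :* v) :+ q :* (c :* t :+ d :* v)) refl a b c d p q t v

  1x+0y≈x : ∀ x y → 1# * x + 0# * y ≈ x
  1x+0y≈x = solve 2 (λ x y → con 1 :* x :+ con 0 :* y := x) refl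

  0x+1y≈y : ∀ x y → 0# * x + 1# * y ≈ y
  0x+1y≈y = solve 2 (λ x y → con 0 :* x :+ con 1 :* y := y) refl

  x1+y0≈x : ∀ x y → x * 1# + y * 0# ≈ x
  x1+y0≈x = solve 2 (λ x y → x :* con 1 :+ y :* con 0 := x) refl

  x0+y1≈y : ∀ x y → x * 0# + y * 1# ≈ y
  x0+y1≈y = solve 2 (λ x y → x :* con 0 :+ y :* con 1 := y) refl

  *ᴹ-identityˡ : ∀ M → Id *ᴹ M ≈ᴹ M
  *ᴹ-identityˡ (mat a b c d) =
    mk≈ᴹ (1x+0y≈x a c) (1x+0y≈x b d) (0x+1y≈y a c) (0x+1y≈y b d)

  *ᴹ-identityʳ : ∀ M → M *ᴹ Id ≈ᴹ M
  *ᴹ-identityʳ (mat a b c d) =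
    mk≈ᴹ (x1+y0≈x a b) (x0+y1≈y a b) (x1+y0≈x c d) (x0+y1≈y c d)

  *ᴹ-monoid : Monoid c ℓ
  *ᴹ-monoid = record
    { isMonoid = record
      { isSemigroup = record
        { isMagma = record
          { isEquivalence = record { refl = ≈ᴹ-refl ; sym = ≈ᴹ-sym ; trans = ≈ᴹ-trans }
          ; ∙-cong        = *ᴹ-cong
          }
        ; assoc = *ᴹ-assoc
        }
      ; identity = *ᴹ-identityˡ , *ᴹ-identityʳ
      }
    }

  open Monoid *ᴹ-monoid using ()
    renaming (setoid to ≈ᴹ-setoid; ∙-congˡ to *ᴹ-congˡ; ∙-congʳ to *ᴹ-congʳ)
  open import Algebra.Properties.Monoid *ᴹ-monoid
    using (cancelᶜ; x∙yz≈xy∙z)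
  open import Relation.Binary.Reasoning.Setoid ≈ᴹ-setoid

  upper lower : Carrier → Matrix₂
  upper c = mat 1# c
                0# 1#
  lower c = mat 1# 0#
                c  1#

  -- As -1 is an opaque variable to the semiring solver, the fact that its square is 1 has to be
  -- supplied by hand.
  -1*-1*x≈x : ∀ x → - 1# * (- 1# * x) ≈ x
  -1*-1*x≈x x = trans (-1*x≈-x _) (trans (-‿cong (-1*x≈-x x)) (-‿involutive x))

  lower-inverseˡ : lower (- 1#) *ᴹ lower 1# ≈ᴹ Id
  lower-inverseˡ = mk≈ᴹ (1x+0y≈x _ _) (1x+0y≈x _ _)
    (trans (+-cong (*-identityʳ _) (*-identityʳ _)) (-‿inverseˡ 1#))
    (x0+y1≈y _ _)

  lower-inverseʳ : lower 1# *ᴹ lower (- 1#) ≈ᴹ Id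
  lower-inverseʳ = mk≈ᴹ (1x+0y≈x _ _) (1x+0y≈x _ _)
    (trans (+-cong (*-identityʳ _) (*-identityˡ _)) (-‿inverseʳ 1#))
    (x0+y1≈y _ _)

  -- The term `- 1# * c` is literally the summand that the matrix product produces in the upper-left
  -- entry.
  η-shiftʳ : ∀ a c → η (a + - 1# * c) ≈ᴹ η a *ᴹ lower c
  η-shiftʳ a c = ≈ᴹ-sym (mk≈ᴹ
    (+-congʳ (*-identityʳ a)) (x0+y1≈y _ _) (1x+0y≈x _ _) (1x+0y≈x _ _))

  η-shiftˡ : ∀ a c → η (a + c) ≈ᴹ upper c *ᴹ η a
  η-shiftˡ a c = ≈ᴹ-sym (mk≈ᴹ
    (+-cong (*-identityˡ a) (*-identityʳ c))
    (solve 2 (λ u c → con 1 :* u :+ c :* con 0 := u) refl (- 1#) c)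
    (0x+1y≈y _ _) (0x+1y≈y _ _))

  η-cong : ∀ {a b} → a ≈ b → η a ≈ᴹ η b
  η-cong a≈b = mk≈ᴹ a≈b refl refl refl

  η[a-1]≈η[a]*lower[1] : ∀ a → η (a - 1#) ≈ᴹ η a *ᴹ lower 1#
  η[a-1]≈η[a]*lower[1] a =
    ≈ᴹ-trans (η-cong (+-congˡ (sym (*-identityʳ _)))) (η-shiftʳ a 1#)

  -- 1 - x is written 1 + (-1) x so that the semiring solver can treat -1 as a variable.
  η[x+b-1] : ∀ x b → η (x + b - 1#) ≈ᴹ η b *ᴹ lower (1# + - 1# * x)
  η[x+b-1] x b = ≈ᴹ-trans (η-cong eq) (η-shiftʳ b (1# + - 1# * x))
    where
    eq : x + b - 1# ≈ b + - 1# * (1# + - 1# * x)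
    eq = trans (+-congʳ (+-congʳ (sym (-1*-1*x≈x x))))
      (solve 3 (λ x b u → u :* (u :* x) :+ b :+ u := b :+ u :* (con 1 :+ u :* x))
        refl x b (- 1#))

  -- Both sides evaluate to `mat x (- 1#) (1# - x) 1#`. The off-diagonal entries agree by semiring
  -- laws alone; the diagonal ones use that -1 is the negative of 1.
  upper*lower : ∀ x → upper (- 1#) *ᴹ lower (1# + - 1# * x) ≈ᴹ lower (- 1#) *ᴹ η x
  upper*lower x = mk≈ᴹ e₁₁
    (solve 1 (λ u → con 1 :* con 0 :+ u :* con 1 := con 1 :* u :+ con 0 :* con 0)
      refl (- 1#))
    (solve 2 (λ x u → con 0 :* con 1 :+ con 1 :* (con 1 :+ u :* x) :=
      u :* x :+ con 1 :* con 1) refl x (- 1#))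
    (trans (0x+1y≈y _ _) (sym (trans (+-cong
      (trans (*-congˡ (sym (*-identityʳ _))) (-1*-1*x≈x 1#)) (zeroʳ 1#)) (+-identityʳ 1#))))
    where
    e₁₁ : 1# * 1# + - 1# * (1# + - 1# * x) ≈ 1# * x + 0# * 1#
    e₁₁ = trans
      (solve 2 (λ x u → con 1 :* con 1 :+ u :* (con 1 :+ u :* x) :=
        (con 1 :+ u) :+ u :* (u :* x)) refl x (- 1#))
      (trans (+-cong (-‿inverseʳ 1#) (-1*-1*x≈x x))
        (trans (+-identityˡ x) (sym (1x+0y≈x x 1#))))

  product-++ : (xs : Vec Carrier m) (ys : Vec Carrier n) →
    product (xs ++ ys) ≈ᴹ product ys *ᴹ product xs
  product-++ []       ys = ≈ᴹ-sym (*ᴹ-identityʳ _)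
  product-++ (x ∷ xs) ys = ≈ᴹ-trans (*ᴹ-congʳ (product-++ xs ys)) (*ᴹ-assoc _ _ _)

  product-cast : .(eq : m ≡ n) (xs : Vec Carrier m) → product (cast eq xs) ≈ᴹ product xs
  product-cast {n = zero}  eq []       = ≈ᴹ-refl
  product-cast {n = suc _} eq (x ∷ xs) = *ᴹ-congʳ (product-cast (suc-injective eq) xs)

  product-splice-zero : ∀ x (xs : Vec Carrier n) (ys : Vec Carrier (suc m)) →
    product (splice (x ∷ xs) zero ys) ≈ᴹ product xs *ᴹ product ys
  product-splice-zero {n = n} {m = m} x xs ys =
    ≈ᴹ-trans (product-cast (cong suc (+-comm-ℕ m n)) (ys ++ xs)) (product-++ ys xs)

  -- The last entry is the leftmost factor, so its shear comes out on the left without crossing any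
  -- other factor.
  product-lower-last : (xs : Vec Carrier (suc n)) →
    product (xs [ fromℕ n ]%= (_- 1#)) ≈ᴹ upper (- 1#) *ᴹ product xs
  product-lower-last (x ∷ [])         =
    ≈ᴹ-trans (*ᴹ-congˡ (η-shiftˡ x (- 1#)))
      (≈ᴹ-trans (*ᴹ-identityˡ _) (*ᴹ-congˡ (≈ᴹ-sym (*ᴹ-identityˡ _))))
  product-lower-last (x ∷ xs@(_ ∷ _)) =
    ≈ᴹ-trans (*ᴹ-congʳ (product-lower-last xs)) (*ᴹ-assoc _ _ _)

  -- With at least two entries, the shears from the first and the last entry sit at opposite ends of
  -- the product of `b`.
  product-attach : ∀ x (b : Vec Carrier (suc (suc m))) → IsIdQuiddity b →
    product (attach x b) ≈ᴹ lower (- 1#) *ᴹ η x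
  product-attach x (b ∷ bs) b≈Id = begin
    product (bs [ fromℕ _ ]%= (_- 1#)) *ᴹ η (x + b - 1#)
      ≈⟨ *ᴹ-cong (product-lower-last bs) (η[x+b-1] x b) ⟩
    (upper (- 1#) *ᴹ product bs) *ᴹ (η b *ᴹ lower (1# + - 1# * x))
      -- `b≈Id` unfolds to `product bs *ᴹ η b ≈ᴹ Id`, which is exactly the inner pair.
      ≈⟨ cancelᶜ b≈Id _ _ ⟩
    upper (- 1#) *ᴹ lower (1# + - 1# * x)
      ≈⟨ upper*lower x ⟩
    lower (- 1#) *ᴹ η x ∎

  -- Since `ys` is known only through its product, the induction can strip the entries before the
  -- splice, which are common right factors of both sides.
  product-splice-inject₁ : (xs : Vec Carrier (suc n)) (i : Fin n)
    (ys : Vec Carrier (suc m)) →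
    product ys ≈ᴹ lower (- 1#) *ᴹ η (lookup xs (inject₁ i)) →
    product (splice (xs [ suc i ]%= (_- 1#)) (inject₁ i) ys) ≈ᴹ product xs
  product-splice-inject₁ (x ∷ y ∷ xs) zero ys ys≈ = begin
    product (splice (x ∷ (y - 1#) ∷ xs) zero ys)
      ≈⟨ product-splice-zero x ((y - 1#) ∷ xs) ys ⟩
    (product xs *ᴹ η (y - 1#)) *ᴹ product ys
      ≈⟨ *ᴹ-cong (*ᴹ-congˡ (η[a-1]≈η[a]*lower[1] y)) ys≈ ⟩
    (product xs *ᴹ (η y *ᴹ lower 1#)) *ᴹ (lower (- 1#) *ᴹ η x)
      ≈⟨ *ᴹ-congʳ (x∙yz≈xy∙z _ _ _) ⟩
    ((product xs *ᴹ η y) *ᴹ lower 1#) *ᴹ (lower (- 1#) *ᴹ η x)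
      ≈⟨ cancelᶜ lower-inverseʳ _ _ ⟩
    (product xs *ᴹ η y) *ᴹ η x ∎
  product-splice-inject₁ (x ∷ xs@(_ ∷ _)) (suc i) ys ys≈ =
    *ᴹ-congʳ (product-splice-inject₁ xs i ys ys≈)

  -- No lowered entry follows inside `xs`, so `lower (- 1#)` survives and surfaces at the left end.
  product-splice-fromℕ : (xs : Vec Carrier (suc n)) (ys : Vec Carrier (suc m)) →
    product ys ≈ᴹ lower (- 1#) *ᴹ η (lookup xs (fromℕ n)) →
    product (splice xs (fromℕ n) ys) ≈ᴹ lower (- 1#) *ᴹ product xs
  product-splice-fromℕ (x ∷ []) ys ys≈ = begin
    product (splice (x ∷ []) zero ys)  ≈⟨ product-splice-zero x [] ys ⟩
    Id *ᴹ product ys                   ≈⟨ *ᴹ-identityˡ _ ⟩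
    product ys                         ≈⟨ ys≈ ⟩
    lower (- 1#) *ᴹ η x                ≈⟨ *ᴹ-congˡ (*ᴹ-identityˡ _) ⟨
    lower (- 1#) *ᴹ (Id *ᴹ η x)        ∎
  product-splice-fromℕ (x ∷ xs@(_ ∷ _)) ys ys≈ =
    ≈ᴹ-trans (*ᴹ-congʳ (product-splice-fromℕ xs ys ys≈)) (*ᴹ-assoc _ _ _)

  -- The lower-left entry is 1 in `η a` and 0 in the identity, so the ring collapses.
  singleton⇒trivial : (a : Vec Carrier 1) → IsIdQuiddity a → ∀ M N → M ≈ᴹ N
  singleton⇒trivial (a ∷ []) a≈Id M N =
    mk≈ᴹ (all≈ _ _) (all≈ _ _) (all≈ _ _) (all≈ _ _)
    where
    1≈0 : 1# ≈ 0#
    1≈0 = trans (sym (0x+1y≈y a 1#)) (_≈ᴹ_.e₂₁-≈ a≈Id)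

    x≈0 : ∀ x → x ≈ 0#
    x≈0 x = trans (sym (*-identityˡ x)) (trans (*-congʳ 1≈0) (zeroˡ x))

    all≈ : ∀ x y → x ≈ y
    all≈ x y = trans (x≈0 x) (sym (x≈0 y))

  ∘-isIdQuiddity : (a : Vec Carrier (suc n)) (b : Vec Carrier (suc m)) →
    IsIdQuiddity a → IsIdQuiddity b → ∀ k → IsIdQuiddity (a ∘⟨ k ⟩ b)
  ∘-isIdQuiddity {n = zero} a _ a≈Id _ _ = singleton⇒trivial a a≈Id _ _
  ∘-isIdQuiddity {n = suc _} {m = zero} _ b _ b≈Id _ = singleton⇒trivial b b≈Id _ _
  -- Splitting on the view that defines `next` makes `next k` reduce to `suc i` or to `zero`.
  ∘-isIdQuiddity {n = suc _} {m = suc _} a b a≈Id b≈Id k with view k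
  ... | ‵inject₁ i = ≈ᴹ-trans
    (product-splice-inject₁ a i (attach _ b) (product-attach _ b b≈Id)) a≈Id
  ∘-isIdQuiddity {n = suc _} {m = suc _} (a ∷ as) b a≈Id b≈Id _ | ‵fromℕ = begin
    product (splice as (fromℕ _) (attach _ b)) *ᴹ η (a - 1#)
      ≈⟨ *ᴹ-cong (product-splice-fromℕ as (attach _ b) (product-attach _ b b≈Id))
                 (η[a-1]≈η[a]*lower[1] a) ⟩
    (lower (- 1#) *ᴹ product as) *ᴹ (η a *ᴹ lower 1#)
      -- Removing the inner `product as *ᴹ η a` brings the two opposite shears together.
      ≈⟨ cancelᶜ a≈Id _ _ ⟩
    lower (- 1#) *ᴹ lower 1#
      ≈⟨ lower-inverseˡ ⟩
    Id ∎

open import Defs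

theorem14 : ∀ {n m : ℕ} (a : Vec ℂ (suc n)) (b : Vec ℂ (suc m)) →
    IsIdQuiddity a → IsIdQuiddity b →
    ∀ (k : Fin (suc n)) → IsIdQuiddity (a ∘⟨ k ⟩ b)
theorem14 = QuiddityProperties.∘-isIdQuiddity ℂ-commutativeRing
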